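{- Let $x$ be a hypergame. Then either there exists a winning strategy on $x$ for exactly one of the players L, R, I, II, and there are no non-losing strategies on $x$ for the other players; or at least two of L, R, I, II have a non-losing strategy on $x$. In this latter case, either (i) or (ii) holds: (i) either L or R (but not both) has a non-losing strategy, and either I or II (but not both) has a non-losing strategy; (ii) all the players L, R, I, II have a non-losing strategy.
   Context: Hypergames: work in a universe of possibly non-wellfounded sets (set theory with the Antifoundation Axiom, and the Axiom of Choice). The class $\mathcal H$ of hypergames (also called games) is the carrier of the final coalgebra $(\mathcal H,\mathrm{id})$ of the functor $F(A)=\mathcal P(A)\times\mathcal P(A)$ on the category of classes and functional classes, where $\mathcal P$ is the powerset functor. Thus a hypergame is a pair $x=(X^L,X^R)$ of sets of hypergames; elements $x^L\in X^L$ and $x^R\in X^R$ are the Left and Right options of $x$. Positions of $x$ are the hypergames hereditarily reachable from $x$. Plays: L (Left) and R (Right) move alternately; either may start. Player I is the one who starts, player II the other one; LI means L acting as player I, and similarly LII, RI, RII. A play on $x$ is a (possibly empty) finite or infinite sequence $x_1^{K_1}x_2^{K_2}\cdots$ with $K_i\in\{L,R\}$ and $K_{i+1}\neq K_i$, such that, with $x_0=x$ and $x_i=(X_i^L,X_i^R)$, one has $x_{i+1}\in X_i^{K_{i+1}}$ for all $i\ge 0$. A finite play is winning for L (resp. R) if it ends with a position $y=(Y^L,Y^R)$ where R (resp. L) is next to move but $Y^R=\emptyset$ (resp. $Y^L=\emptyset$); the empty play ends at $x$ with the starting player next to move. Every infinite play is a draw. A play is non-losing for L (resp. R) if it is winning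 for L (resp. R) or is a draw. Strategies: for P in $\{$LI, LII, RI, RII$\}$ let $\mathrm{FPlay}^P_x$ be the set of finite plays on $x$ in which P has the prescribed role (first or second player) and is next to move (the empty play is included exactly when P is LI or RI). A strategy for P on $x$ is a partial function $f$ from $\mathrm{FPlay}^P_x$ to positions of $x$ such that $f(\pi)=x'$ implies that $\pi x'$ is a play, and $f(\pi)$ is defined whenever some $\pi x'$ is a play. The opponent of LI is RII, and of LII is RI (and conversely). A play $\pi$ is coherent with $f$ if for each proper prefix $\pi'$ of $\pi$ where P is next to move, $f(\pi')=x'$ implies $\pi'x'$ is a prefix of $\pi$. For a strategy $f$ for P and a strategy $f'$ for the opponent, $f*f'$ is the unique maximal play coherent with both. $f$ is non-losing (winning) for P if $f*f'$ is non-losing (winning) for P (i.e. for L or R accordingly) for every strategy $f'$ of the opponent. A strategy for L is a pair of strategies for LI and LII; for R, for RI and RII; for I, for LI and RI; for II, for LII and RII. Such a pair is non-losing (winning) if both components are. -}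

module Defs where

open import Data.Empty using (⊥)
open import Data.List using (List; []; _∷_; _∷ʳ_; length; applyUpTo)
open import Data.List.Relation.Binary.Pointwise as List using ()
open import Data.List.Relation.Binary.Prefix.Heterogeneous using (Prefix)
open import Data.Maybe using (Maybe; just)
import Data.Maybe.Relation.Binary.Pointwise as Maybe
open import Data.Nat using (ℕ; _<_)
open import Data.Product using (_×_; _,_; proj₁; proj₂; ∃; ∃-syntax)
open import Data.Product.Relation.Binary.Pointwise.NonDependent as Product using (×-setoid)
open import Data.Sum using (_⊎_)
open import Function using (_∘_)
open import Function.Bundles using (Func; Surjection)
open import Level using (Level; 0ℓ; suc; _⊔_)
open import Relation.Binary.Bundles using (Setoid)
open import Relation.Binary.PropositionalEquality using (_≡_; _≢_)
open import Relation.Nullary using (¬_)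

open Setoid using () renaming (Carrier to ∣_∣)

1ℓ : Level
1ℓ = suc 0ℓ

-- Every surjection splits.  The section has to respect the equality of its
-- domain, so this is not the choice principle that is provable for Σ-types;
-- by Diaconescu's argument it also yields excluded middle for Set ℓ.
AxiomOfChoice : ∀ c ℓ → Set (suc (c ⊔ ℓ))
AxiomOfChoice c ℓ = {A B : Setoid c ℓ} (f : Surjection A B) →
  ∃ λ (g : Func B A) → ∀ y → Setoid._≈_ B (Surjection.to f (Func.to g y)) y

------------------------------------------------------------------------
-- The final coalgebra of F(A) = 𝒫(A) × 𝒫(A)

-- Sets are small types and classes are large ones; since there are no
-- quotients, a class carries its own equality and a functional class is a
-- map respecting it.
Class : Set₂
Class = Setoid 1ℓ 1ℓ

-- A subset of a class, presented as the image of a small family.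
record Family (A : Set₁) : Set₁ where
  constructor family
  field
    Index : Set
    elem  : Index → A
open Family

module _ (A : Class) where
  open Setoid A

  Member : Carrier → Family Carrier → Set₁
  Member a U = ∃ λ i → elem U i ≈ a

  -- extensionality: two families are equal when they have the same elements
  𝒫 : Class
  𝒫 = record
    { Carrier = Family Carrier
    ; _≈_ = λ U V → (∀ i → Member (elem U i) V) × (∀ j → Member (elem V j) U)
    ; isEquivalence = record
      { refl  = (λ i → i , refl) , (λ i → i , refl)
      ; sym   = λ (p , q) → q , p
      ; trans = λ (p , q) (r , s) →
          (λ i → let j , e = p i ; k , d = r j in k , trans d e) ,
          (λ k → let j , e = s k ; i , d = q j in i , trans d e)
      }
    }

  F : Class
  F = ×-setoid 𝒫 𝒫

𝒫-map : {A B : Set₁} → (A → B) → Family A → Family B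
𝒫-map f U = family (Index U) (f ∘ elem U)

F-map : {A B : Set₁} → (A → B) → Family A × Family A → Family B × Family B
F-map f (U , V) = 𝒫-map f U , 𝒫-map f V

record Coalgebra : Set₂ where
  field
    carrier : Class
    out     : Func carrier (F carrier)
open Coalgebra

record Morphism (C D : Coalgebra) : Set₁ where
  field
    fun      : Func (carrier C) (carrier D)
    commutes : ∀ a → Setoid._≈_ (F (carrier D))
      (Func.to (out D) (Func.to fun a))
      (F-map (Func.to fun) (Func.to (out C) a))
open Morphism

-- The structure map of the final coalgebra is an isomorphism, by Lambek's
-- lemma; it plays the role of the identity that one has for non-wellfounded
-- sets.  A final coalgebra exists: small pointed graphs up to bisimilarity.
record FinalCoalgebra : Set₂ where
  field
    coalgebra : Coalgebra
    unfold    : ∀ C → Morphism C coalgebra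
    unique    : ∀ C (h h′ : Morphism C coalgebra) a →
      Setoid._≈_ (carrier coalgebra) (Func.to (fun h) a) (Func.to (fun h′) a)

------------------------------------------------------------------------
-- Players

data Side : Set where
  L R : Side

opposite : Side → Side
opposite L = R
opposite R = L

-- Seat combines a side with the role of first (I) or second (II) player.
data Seat : Set where
  LI LII RI RII : Seat

side : Seat → Side
side LI  = L
side LII = L
side RI  = R
side RII = R

starter : Seat → Side
starter LI  = L
starter LII = R
starter RI  = R
starter RII = L

opponent : Seat → Seat
opponent LI  = RII
opponent LII = RI
opponent RI  = LII
opponent RII = LI

data Player : Set where
  L R I II : Player

seat₁ seat₂ : Player → Seat
seat₁ L  = LI
seat₁ R  = RI
seat₁ I  = LI
seat₁ II = LII
seat₂ L  = LII
seat₂ R  = RII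
seat₂ I  = RI
seat₂ II = RII

------------------------------------------------------------------------
-- Games, plays and strategies

module Games (𝓗 : FinalCoalgebra) where

  private
    𝐇 : Class
    𝐇 = carrier (FinalCoalgebra.coalgebra 𝓗)

  open Setoid 𝐇 using (_≈_)

  Hypergame : Set₁
  Hypergame = ∣ 𝐇 ∣

  options : Side → Hypergame → Family Hypergame
  options L x = proj₁ (Func.to (out (FinalCoalgebra.coalgebra 𝓗)) x)
  options R x = proj₂ (Func.to (out (FinalCoalgebra.coalgebra 𝓗)) x)

  _∈[_]_ : Hypergame → Side → Hypergame → Set₁
  y ∈[ K ] x = Member 𝐇 y (options K x)

  -- (K , y) stands for y^K
  Move : Set₁
  Move = Side × Hypergame

  _≈ₘ_ : Move → Move → Set₁
  _≈ₘ_ = Product.Pointwise _≡_ _≈_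

  _≋_ : List Move → List Move → Set₁
  _≋_ = List.Pointwise _≈ₘ_

  data Sequence : Set₁ where
    fin : List Move → Sequence
    inf : (ℕ → Move) → Sequence

  -- Chain K x π: π is a finite play on x in which K makes the first move.
  -- For π = [] this fixes who is to move first, which the sequence itself
  -- does not record.
  data Chain : Side → Hypergame → List Move → Set₁ where
    []  : ∀ {K x} → Chain K x []
    _∷_ : ∀ {K x y π} → y ∈[ K ] x → Chain (opposite K) y π → Chain K x ((K , y) ∷ π)

  IsPlay : Side → Hypergame → Sequence → Set₁
  IsPlay K x (fin π) = Chain K x π
  IsPlay K x (inf σ) = ∀ n → Chain K x (applyUpTo σ n)

  next : Side → List Move → Side
  next K []            = K
  next _ ((K , _) ∷ π) = next (opposite K) π

  end : Hypergame → List Move → Hypergame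
  end x []            = x
  end _ ((_ , y) ∷ π) = end y π

  _⊑_ : Sequence → Sequence → Set₁
  fin π ⊑ fin ρ = Prefix _≈ₘ_ π ρ
  fin π ⊑ inf σ = π ≋ applyUpTo σ (length π)
  inf σ ⊑ fin ρ = Level.Lift 1ℓ ⊥
  inf σ ⊑ inf τ = ∀ n → σ n ≈ₘ τ n

  _⊏_ : List Move → Sequence → Set₁
  π ⊏ fin ρ = fin π ⊑ fin ρ × length π < length ρ
  π ⊏ inf σ = fin π ⊑ inf σ

  -- K₀ is the starting player.
  data WinningPlay (K K₀ : Side) (x : Hypergame) : Sequence → Set₁ where
    stuck : ∀ {π} → next K₀ π ≡ opposite K →
      (∀ y → ¬ y ∈[ opposite K ] end x π) → WinningPlay K K₀ x (fin π)

  data Draw : Sequence → Set₁ where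
    infinite : ∀ {σ} → Draw (inf σ)

  NonLosingPlay : Side → Side → Hypergame → Sequence → Set₁
  NonLosingPlay K K₀ x π = WinningPlay K K₀ x π ⊎ Draw π

  record FPlay (P : Seat) (x : Hypergame) : Set₁ where
    field
      moves  : List Move
      isPlay : Chain (starter P) x moves
      isNext : next (starter P) moves ≡ side P
  open FPlay public

  _▹_ : ∀ {P x} → FPlay P x → Hypergame → List Move
  _▹_ {P} π y = moves π ∷ʳ (side P , y)

  -- A partial function; being a function on plays, it may depend neither on
  -- the representatives of the positions nor on the proofs in FPlay.
  record Strategy (P : Seat) (x : Hypergame) : Set₁ where
    field
      move    : FPlay P x → Maybe Hypergame
      cong    : ∀ {π π′} → moves π ≋ moves π′ → Maybe.Pointwise _≈_ (move π) (move π′)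
      legal   : ∀ {π y} → move π ≡ just y → Chain (starter P) x (π ▹ y)
      defined : ∀ {π y} → Chain (starter P) x (π ▹ y) → ∃[ z ] move π ≡ just z
  open Strategy public

  Coherent : ∀ {P x} → Strategy P x → Sequence → Set₁
  Coherent {P} {x} f π = ∀ (π′ : FPlay P x) → moves π′ ⊏ π →
    ∀ {y} → move f π′ ≡ just y → fin (π′ ▹ y) ⊑ π

  -- Only plays begun by the starter of P are compared: a play with the other
  -- starter would be coherent with f vacuously when f is undefined on the
  -- empty play.
  record JointPlay {P x} (f : Strategy P x) (f′ : Strategy (opponent P) x)
                   (π : Sequence) : Set₁ where
    field
      play      : IsPlay (starter P) x π
      coherent  : Coherent f π
      coherent′ : Coherent f′ π

  -- π is f * f′, which is determined only up to equality of hypergames.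
  record _∗_↦_ {P x} (f : Strategy P x) (f′ : Strategy (opponent P) x)
               (π : Sequence) : Set₁ where
    field
      joint   : JointPlay f f′ π
      maximal : ∀ ρ → JointPlay f f′ ρ → π ⊑ ρ → ρ ⊑ π

  Winning NonLosing : ∀ {P x} → Strategy P x → Set₁
  Winning {P} {x} f = ∀ f′ → ∃[ π ] (f ∗ f′ ↦ π) × WinningPlay (side P) (starter P) x π
  NonLosing {P} {x} f = ∀ f′ → ∃[ π ] (f ∗ f′ ↦ π) × NonLosingPlay (side P) (starter P) x π

  PlayerStrategy : Player → Hypergame → Set₁
  PlayerStrategy p x = Strategy (seat₁ p) x × Strategy (seat₂ p) x

  HasWinning HasNonLosing : Player → Hypergame → Set₁
  HasWinning p x = ∃ λ ((f , g) : PlayerStrategy p x) → Winning f × Winning g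
  HasNonLosing p x = ∃ λ ((f , g) : PlayerStrategy p x) → NonLosing f × NonLosing g

  ExactlyOneWins : Hypergame → Set₁
  ExactlyOneWins x = ∃[ p ] HasWinning p x
    × (∀ q → HasWinning q x → q ≡ p)
    × (∀ q → q ≢ p → ¬ HasNonLosing q x)

  AtLeastTwoNonLosing : Hypergame → Set₁
  AtLeastTwoNonLosing x = ∃[ p ] ∃[ q ] p ≢ q × HasNonLosing p x × HasNonLosing q x

EitherNotBoth : Set₁ → Set₁ → Set₁
EitherNotBoth A B = (A ⊎ B) × ¬ (A × B)

module Submission where

-- Fix who starts.  The positions from which a side K can force a win form an
-- inductively defined class (Forces), and by excluded middle either L can
-- force a win from x, or R can, or neither can.  If K can, then K has a
-- winning strategy and the opponent no non-losing one (forced⇒wins,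
-- forced⇒opponentLoses).  A side whose opponent cannot force a win has a
-- non-losing strategy: always move to a position from which the opponent still
-- cannot (unforced⇒nonLosing); then the opponent never gets to a won position,
-- in particular never to one where K is stuck.  So each of the two games, the
-- one begun by L and the one begun by R, is won, lost or drawn (Verdict).  A
-- player owns one seat in each of them, and the nine combinations of verdicts
-- give the theorem: two decisive games make one player the winner, one
-- decisive and one drawn game give case (i), and two drawn games case (ii).
--
-- The work lies in making strategies functions on plays up to equality of
-- hypergames.  The axiom of choice assigns to the options of each position
-- canonical indices; thereby a play is read as a sequence of indices, a Line,
-- which is the same for equal plays (trace-unique).  Anything computed from
-- the line, called Advice, is then a strategy (advised).  The winning strategy
-- follows a fixed derivation of Forces down its subderivations, which makes
-- every play finite (follow-wins).
--
-- The definitions of winning and non-losing also demand that f ∗ f′ exists.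
-- It is produced move by move (result); a play that is infinite or ends
-- because the side to move has no option cannot be prolonged, hence is maximal
-- (over-maximal).  Excluded middle is needed here as well, to decide whether
-- the play halts, and follows from choice (excludedMiddle).

open import Defs
open import Level using (0ℓ; Lift; lift; lower)
open import Data.Bool using (Bool; true; false)
import Data.Bool.Properties as Bool
open import Data.Empty using (⊥-elim)
open import Data.List using (List; []; _∷_; _∷ʳ_; length; applyUpTo)
open import Data.List.Relation.Binary.Pointwise as List using ([]; _∷_)
open import Data.List.Relation.Binary.Prefix.Heterogeneous using (Prefix; []; _∷_)
open import Data.Maybe using (Maybe; just; nothing)
import Data.Maybe.Relation.Binary.Pointwise as Maybe
open import Data.Nat using (ℕ; zero; suc; s≤s; z≤n)
open import Data.Product using (_×_; _,_; proj₁; proj₂; ∃; ∃-syntax)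
open import Data.Sum using (_⊎_; inj₁; inj₂; [_,_]′)
open import Function using (_∘_; id)
open import Function.Bundles using (Func)
open import Relation.Binary.Bundles using (Setoid)
open import Relation.Binary.PropositionalEquality as ≡ using (_≡_; _≢_; refl)
open import Relation.Nullary using (¬_; Dec; yes; no)
open import Relation.Nullary.Decidable using (decidable-stable)

open Family

-- Normal forms and excluded middle

discrete : Set → Setoid 0ℓ 1ℓ
discrete A = record
  { Carrier = A
  ; _≈_ = λ a b → Lift 1ℓ (a ≡ b)
  ; isEquivalence = record
    { refl  = lift refl
    ; sym   = λ (lift e) → lift (≡.sym e)
    ; trans = λ (lift e) (lift e′) → lift (≡.trans e e′)
    }
  }

abstract
  -- The surjection to split is the identity, from the discrete copy of a
  -- setoid onto the setoid.
  normalForms : AxiomOfChoice 0ℓ 1ℓ → (S : Setoid 0ℓ 1ℓ) → let open Setoid S in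
    ∃ λ (nf : Carrier → Carrier) →
      (∀ a → nf a ≈ a) × (∀ {a b} → a ≈ b → nf a ≡ nf b)
  normalForms choice S =
    let g , section = choice {A = discrete (Setoid.Carrier S)} {B = S} record
          { to         = id
          ; cong       = λ (lift e) → reflexive e
          ; surjective = λ a → a , λ (lift e) → reflexive e
          }
    in Func.to g , section , λ e → lower (Func.cong g e)
    where open Setoid S using (reflexive)

  -- Diaconescu's argument: the truth values are glued together exactly when
  -- A holds, so comparing their normal forms decides A.
  excludedMiddle : AxiomOfChoice 0ℓ 1ℓ → (A : Set₁) → Dec A
  excludedMiddle choice A with normalForms choice glued
    where
    glued : Setoid 0ℓ 1ℓ
    glued = record
      { Carrier = Bool
      ; _≈_ = λ a b → a ≡ b ⊎ A
      ; isEquivalence = record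
        { refl  = inj₁ refl
        ; sym   = λ { (inj₁ e) → inj₁ (≡.sym e) ; (inj₂ a) → inj₂ a }
        ; trans = λ { (inj₁ refl) q → q ; (inj₂ a) _ → inj₂ a }
        }
      }
  ... | nf , nf-≈ , nf-cong with nf true Bool.≟ nf false
  ...   | no nf≢ = no λ a → nf≢ (nf-cong (inj₂ a))
  ...   | yes nf≡ with nf-≈ true | nf-≈ false
  ...     | inj₂ a | _      = yes a
  ...     | _      | inj₂ a = yes a
  ...     | inj₁ t | inj₁ f with ≡.trans (≡.sym t) (≡.trans nf≡ f)
  ...       | ()

-- Alternation of the sides

opposite-involutive : ∀ K → opposite (opposite K) ≡ K
opposite-involutive L = refl
opposite-involutive R = refl

opposite-≢ : ∀ K → K ≢ opposite K
opposite-≢ L ()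
opposite-≢ R ()

whose : ∀ K M → M ≡ K ⊎ M ≡ opposite K
whose L L = inj₁ refl
whose L R = inj₂ refl
whose R L = inj₂ refl
whose R R = inj₁ refl

-- Equality of players

_≟_ : (p q : Player) → Dec (p ≡ q)
L  ≟ L  = yes refl
L  ≟ R  = no λ ()
L  ≟ I  = no λ ()
L  ≟ II = no λ ()
R  ≟ L  = no λ ()
R  ≟ R  = yes refl
R  ≟ I  = no λ ()
R  ≟ II = no λ ()
I  ≟ L  = no λ ()
I  ≟ R  = no λ ()
I  ≟ I  = yes refl
I  ≟ II = no λ ()
II ≟ L  = no λ ()
II ≟ R  = no λ ()
II ≟ I  = no λ ()
II ≟ II = yes refl

module Determinacy (choice : AxiomOfChoice 0ℓ 1ℓ) (𝓗 : FinalCoalgebra) where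
  open Games 𝓗
  open Setoid (Coalgebra.carrier (FinalCoalgebra.coalgebra 𝓗))
    using (_≈_) renaming (refl to ≈-refl; sym to ≈-sym; trans to ≈-trans)

  em : (A : Set₁) → Dec A
  em = excludedMiddle choice

  -- Moves and finite plays up to equality of positions

  matchingOption : ∀ M {x y} → x ≈ y → (i : Index (options M x)) →
    ∃ λ j → elem (options M y) j ≈ elem (options M x) i
  matchingOption L e = proj₁ (proj₁ (Func.cong (Coalgebra.out (FinalCoalgebra.coalgebra 𝓗)) e))
  matchingOption R e = proj₁ (proj₂ (Func.cong (Coalgebra.out (FinalCoalgebra.coalgebra 𝓗)) e))

  ∈-resp : ∀ M {x y w} → x ≈ y → w ∈[ M ] x → w ∈[ M ] y
  ∈-resp M e (i , e′) = let j , e″ = matchingOption M e i in j , ≈-trans e″ e′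

  ≋-refl : ∀ π → π ≋ π
  ≋-refl []      = []
  ≋-refl (_ ∷ π) = (refl , ≈-refl) ∷ ≋-refl π

  ∈-side : ∀ {J K x w} → J ≡ K → w ∈[ J ] x → w ∈[ K ] x
  ∈-side refl = id

  Chain-resp : ∀ {M x y π} → x ≈ y → Chain M x π → Chain M y π
  Chain-resp     e []      = []
  Chain-resp {M} e (m ∷ c) = ∈-resp M e m ∷ c

  Chain-∷ʳ : ∀ {M K x w π} → Chain M x π → next M π ≡ K → w ∈[ K ] end x π →
    Chain M x (π ∷ʳ (K , w))
  Chain-∷ʳ []      refl m = m ∷ []
  Chain-∷ʳ (n ∷ c) e    m = n ∷ Chain-∷ʳ c e m

  lastMove : ∀ {M x} K {w} π → Chain M x (π ∷ʳ (K , w)) → w ∈[ K ] end x π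
  lastMove K []      (m ∷ _) = m
  lastMove K (_ ∷ π) (_ ∷ c) = lastMove K π c

  -- Forced wins

  -- K can force a win from x when M is to move.  The base case is a reply with
  -- no options, where the opponent is stuck.
  data Forces (K M : Side) (x : Hypergame) : Set₁ where
    choose : M ≡ K → (i : Index (options M x)) →
      Forces K (opposite M) (elem (options M x) i) → Forces K M x
    reply  : M ≡ opposite K →
      (∀ i → Forces K (opposite M) (elem (options M x) i)) → Forces K M x

  Forces-resp : ∀ {K M x y} → x ≈ y → Forces K M x → Forces K M y
  Forces-resp {M = M} e (choose t i d) =
    let j , e′ = matchingOption M e i in choose t j (Forces-resp (≈-sym e′) d)
  Forces-resp {M = M} e (reply t h) = reply t λ j →
    let i , e′ = matchingOption M (≈-sym e) j in Forces-resp e′ (h i)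

  -- Advice: a representation of strategies that respects equality

  -- A play given by the indices of its moves rather than by the positions.
  data Line (M : Side) (x : Hypergame) : Set where
    []  : Line M x
    _∷_ : (i : Index (options M x)) → Line (opposite M) (elem (options M x) i) →
      Line M x

  tip : ∀ {M x} → Line M x → Hypergame
  tip {x = x} [] = x
  tip (_ ∷ l)    = tip l

  byElem : Family Hypergame → Setoid 0ℓ 1ℓ
  byElem U = record
    { Carrier = Index U
    ; _≈_ = λ i j → elem U i ≈ elem U j
    ; isEquivalence = record { refl = ≈-refl ; sym = ≈-sym ; trans = ≈-trans }
    }

  canonical : (U : Family Hypergame) → Index U → Index U
  canonical U = proj₁ (normalForms choice (byElem U))

  canonical-≈ : ∀ U i → elem U (canonical U i) ≈ elem U i
  canonical-≈ U = proj₁ (proj₂ (normalForms choice (byElem U)))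

  canonical-≡ : ∀ U {i j} → elem U i ≈ elem U j → canonical U i ≡ canonical U j
  canonical-≡ U = proj₂ (proj₂ (normalForms choice (byElem U)))

  read : ∀ M {x y w} → x ≈ y → w ∈[ M ] y →
    ∃ λ i → elem (options M x) i ≈ w
  read M {x} e m =
    let i , e′ = ∈-resp M (≈-sym e) m
    in canonical (options M x) i , ≈-trans (canonical-≈ (options M x) i) e′

  read-unique : ∀ M {x y y′ w w′} (e : x ≈ y) (e′ : x ≈ y′)
    (m : w ∈[ M ] y) (m′ : w′ ∈[ M ] y′) → w ≈ w′ →
    proj₁ (read M e m) ≡ proj₁ (read M e′ m′)
  read-unique M {x} e e′ m m′ w≈w′ = canonical-≡ (options M x)
    (≈-trans (proj₂ (∈-resp M (≈-sym e) m))
      (≈-trans w≈w′ (≈-sym (proj₂ (∈-resp M (≈-sym e′) m′)))))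

  trace : ∀ {M x y π} → Chain M y π → x ≈ y → Line M x
  trace     []      e = []
  trace {M} (m ∷ c) e = proj₁ (read M e m) ∷ trace c (proj₂ (read M e m))

  tip-trace : ∀ {M x y π} (c : Chain M y π) (e : x ≈ y) → tip (trace c e) ≈ end y π
  tip-trace     []      e = e
  tip-trace {M} (m ∷ c) e = tip-trace c (proj₂ (read M e m))

  -- Since the indices are canonical, equal plays leave identical traces;
  -- whatever is computed from the trace respects equality of plays.
  trace-unique : ∀ {M x y y′ π π′} (c : Chain M y π) (c′ : Chain M y′ π′)
    (e : x ≈ y) (e′ : x ≈ y′) → π ≋ π′ → trace c e ≡ trace c′ e′
  trace-unique []      []        e e′ [] = refl
  trace-unique {M} {x} (m ∷ c) (m′ ∷ c′) e e′ ((_ , w≈w′) ∷ p) =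
    extend (read-unique M e e′ m m′ w≈w′) (proj₂ (read M e m)) (proj₂ (read M e′ m′))
    where
    extend : ∀ {i i′ : Index (options M x)} → i ≡ i′ →
      (f : elem (options M x) i ≈ _) (f′ : elem (options M x) i′ ≈ _) →
      _≡_ {A = Line M x} (i ∷ trace c f) (i′ ∷ trace c′ f′)
    extend refl f f′ = ≡.cong (_ ∷_) (trace-unique c c′ f f′ p)

  -- Given the play so far and an arbitrary option for K, the option that K
  -- should prefer to it; so advice exists at dead ends, too.
  Advice : Side → Side → Hypergame → Set
  Advice K M x = (l : Line M x) → Index (options K (tip l)) → Index (options K (tip l))

  -- The inhabitant of the index set that excluded middle returns is the
  -- fallback on which the advice improves.
  pick : (U : Family Hypergame) → (Index U → Index U) → Maybe Hypergame
  pick U a with em (Lift 1ℓ (Index U))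
  ... | yes (lift i) = just (elem U (a i))
  ... | no _         = nothing

  pick-elem : ∀ U a {w} → pick U a ≡ just w → ∃ λ i → elem U i ≈ w
  pick-elem U a eq with em (Lift 1ℓ (Index U))
  pick-elem U a refl | yes (lift i) = a i , ≈-refl

  pick-total : ∀ U a → Index U → ∃ λ i → pick U a ≡ just (elem U (a i))
  pick-total U a i with em (Lift 1ℓ (Index U))
  ... | yes (lift j) = j , refl
  ... | no ∄         = ⊥-elim (∄ (lift i))

  heed : ∀ K {M x} → Advice K M x → Line M x → Maybe Hypergame
  heed K a l = pick (options K (tip l)) (a l)

  -- The axioms of a strategy, legality and definedness, hold for any advice
  -- because advice is asked for exactly when there is an option.
  advised : ∀ P {x} → Advice (side P) (starter P) x → Strategy P x
  advised P {x} a = record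
    { move    = λ π → heed (side P) a (trace (isPlay π) ≈-refl)
    ; cong    = λ {π} {π′} p → Maybe.reflexive (λ { refl → ≈-refl })
        (≡.cong (heed (side P) a) (trace-unique (isPlay π) (isPlay π′) ≈-refl ≈-refl p))
    ; legal   = λ {π} eq → Chain-∷ʳ (isPlay π) (isNext π)
        (∈-resp (side P) (tip-trace (isPlay π) ≈-refl) (pick-elem (options (side P) _) _ eq))
    ; defined = λ {π} c →
        let i , _  = ∈-resp (side P) (≈-sym (tip-trace (isPlay π) ≈-refl))
                       (lastMove (side P) (moves π) c)
            _ , eq = pick-total (options (side P) _) (a (trace (isPlay π) ≈-refl)) i
        in _ , eq
    }

  -- Plays that obey one side's strategy, move by move

  Ask : Side → Side → Hypergame → Set₁
  Ask K M x = ∀ π → Chain M x π → next M π ≡ K → Maybe Hypergame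

  -- Coherence without reference to seats, so that it can be passed on to the
  -- part of a play after its first move.
  Obeys : ∀ {K M x} → Ask K M x → Sequence → Set₁
  Obeys {K} {M} {x} ask s = ∀ π (c : Chain M x π) (t : next M π ≡ K) → π ⊏ s →
    ∀ {w} → ask π c t ≡ just w → fin (π ∷ʳ (K , w)) ⊑ s

  askAfter : ∀ {K M x y} → Ask K M x → y ∈[ M ] x → Ask K (opposite M) y
  askAfter ask m π c = ask (_ ∷ π) (m ∷ c)

  -- What an induction on plays needs after one move: the rest is again an
  -- obedient play, with the same result.
  record FirstMove {K M x} (ask : Ask K M x) (s : Sequence) : Set₁ where
    field
      {target} : Hypergame
      {rest}   : Sequence
      step     : target ∈[ M ] x
      play     : IsPlay (opposite M) target rest
      obeys    : Obeys (askAfter ask step) rest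
      asked    : (t : M ≡ K) → ∀ {w} → ask [] [] t ≡ just w → w ≈ target
      winning  : ∀ {J} → WinningPlay J M x s → WinningPlay J (opposite M) target rest
      draw     : Draw s → Draw rest
  open FirstMove

  firstMove-fin : ∀ {K M x y π} (ask : Ask K M x) (m : y ∈[ M ] x) →
    Chain (opposite M) y π → Obeys ask (fin ((M , y) ∷ π)) →
    FirstMove ask (fin ((M , y) ∷ π))
  firstMove-fin ask m c o = record
    { step    = m
    ; play    = c
    ; obeys   = λ π c′ t (p , lt) eq →
        tailPrefix (o (_ ∷ π) (m ∷ c′) t ((refl , ≈-refl) ∷ p , s≤s lt) eq)
    ; asked   = λ t eq → headPrefix (o [] [] t ([] , s≤s z≤n) eq)
    ; winning = λ { (stuck t none) → stuck t none }
    ; draw    = λ ()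
    }
    where
    tailPrefix : ∀ {m m′ π π′} → Prefix _≈ₘ_ (m ∷ π) (m′ ∷ π′) → Prefix _≈ₘ_ π π′
    tailPrefix (_ ∷ p) = p
    headPrefix : ∀ {K y K′ y′ π π′} →
      Prefix _≈ₘ_ ((K , y) ∷ π) ((K′ , y′) ∷ π′) → y ≈ y′
    headPrefix ((_ , e) ∷ _) = e

  uncons : ∀ {M x m π} → Chain M x (m ∷ π) →
    proj₁ m ≡ M × proj₂ m ∈[ M ] x × Chain (opposite M) (proj₂ m) π
  uncons (m ∷ c) = refl , m , c

  firstMove-inf : ∀ {K M x σ} (ask : Ask K M x) →
    IsPlay M x (inf σ) → Obeys ask (inf σ) → FirstMove ask (inf σ)
  firstMove-inf {σ = σ} ask p o = record
    { step    = m
    ; play    = λ n → proj₂ (proj₂ (uncons (p (suc n))))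
    ; obeys   = λ π c t q eq → List.tail
        (o (_ ∷ π) (m ∷ c) t ((≡.sym (proj₁ (uncons (p 1))) , ≈-refl) ∷ q) eq)
    ; asked   = λ t eq → proj₂ (List.head (o [] [] t [] eq))
    ; winning = λ ()
    ; draw    = λ _ → infinite
    }
    where m = proj₁ (proj₂ (uncons (p 1)))

  firstMove : ∀ {K M x} (ask : Ask K M x) s → IsPlay M x s → Obeys ask s →
    s ≡ fin [] ⊎ FirstMove ask s
  firstMove ask (fin [])      _       o = inj₁ refl
  firstMove ask (fin (_ ∷ _)) (m ∷ c) o = inj₂ (firstMove-fin ask m c o)
  firstMove ask (inf σ)       p       o = inj₂ (firstMove-inf ask p o)

  -- The indices on a line are those of one representative of each position,
  -- whereas a play may run through others; hence both x and y.
  asking : ∀ K {M x y} → Advice K M x → x ≈ y → Ask K M y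
  asking K a e π c _ = heed K a (trace c e)

  -- Winning strategies

  -- K remembers the part of the forced win that the play has reached.  This
  -- part strictly shrinks, whereas choosing at each position some winning
  -- option might go on forever.
  mutual
    follow : ∀ {K M x y} → Forces K M x → x ≈ y → Advice K M y
    follow {M = M} (choose refl i d) e [] _    = proj₁ (matchingOption M e i)
    follow (choose _ i d)            e (j ∷ l) = followMove d (em _) l
    follow (reply _ h)               e []      = id
    follow {M = M} (reply _ h)       e (j ∷ l) =
      let i , e′ = matchingOption M (≈-sym e) j in follow (h i) e′ l

    followMove : ∀ {K M x y} → Forces K M x → Dec (x ≈ y) → Advice K M y
    followMove d (yes e) = follow d e
    -- K has deviated; from here on any option will do.
    followMove d (no _)  = λ _ → id

  -- By induction on d: each move leads to a subderivation, and at the end of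
  -- the play d shows that K is not the one who is stuck.  The hypergames x, y
  -- and z are equal representatives for d, the advice and the play.
  follow-wins : ∀ {K M x y z} (d : Forces K M x) (e : x ≈ y) (e′ : y ≈ z) s →
    IsPlay M z s → Obeys (asking K (follow d e) e′) s →
    ¬ NonLosingPlay (opposite K) M z s
  followMove-wins : ∀ {K M x y z} (d : Forces K M x) (q : Dec (x ≈ y)) → x ≈ y →
    (e′ : y ≈ z) → ∀ s → IsPlay M z s → Obeys (asking K (followMove d q) e′) s →
    ¬ NonLosingPlay (opposite K) M z s

  follow-wins {K} {M} d e e′ s p o nl with firstMove (asking K (follow d e) e′) s p o
  follow-wins {K} (choose refl i d) e e′ _ p o (inj₁ (stuck _ none)) | inj₁ refl =
    none _ (∈-side (≡.sym (opposite-involutive K))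
      (∈-resp K (≈-trans e e′) (i , ≈-refl)))
  follow-wins {K} (reply refl h) e e′ _ p o (inj₁ (stuck t none)) | inj₁ refl =
    opposite-≢ (opposite K) t
  follow-wins {K} {M} {y = y} (choose refl i d) e e′ s p o nl | inj₂ f =
    followMove-wins d (em _) i≈j (proj₂ (read M e′ (step f))) (rest f) (play f) (obeys f)
      ([ inj₁ ∘ winning f , inj₂ ∘ draw f ]′ nl)
    where
    k = matchingOption M e i
    i≈j = ≈-trans (≈-sym (proj₂ k)) (≈-trans
      (asked f refl (proj₂ (pick-total (options M y) (λ _ → proj₁ k) (proj₁ k))))
      (≈-sym (proj₂ (read M e′ (step f)))))
  follow-wins {K} {M} (reply _ h) e e′ s p o nl | inj₂ f =
    follow-wins (h _) _ (proj₂ (read M e′ (step f))) (rest f) (play f) (obeys f)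
      ([ inj₁ ∘ winning f , inj₂ ∘ draw f ]′ nl)

  followMove-wins d (yes e) _ e′ s p o = follow-wins d e e′ s p o
  followMove-wins d (no ¬e) e e′ s p o = ⊥-elim (¬e e)

  -- Non-losing strategies

  SafeOption : Side → Hypergame → Set₁
  SafeOption K x = ∃ λ i → ¬ Forces (opposite K) (opposite K) (elem (options K x) i)

  prefer : ∀ K x → Index (options K x) → Index (options K x)
  prefer K x i with em (SafeOption K x)
  ... | yes (j , _) = j
  ... | no _        = i

  safe : ∀ K {M x} → Advice K M x
  safe K l = prefer K (tip l)

  safe-option : ∀ {K x} → ¬ Forces (opposite K) K x → SafeOption K x
  safe-option {K} ¬d = decidable-stable (em _) λ ∄ →
    ¬d (reply (≡.sym (opposite-involutive K)) λ i →
      decidable-stable (em _) λ ¬d′ → ∄ (i , ¬d′))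

  safe-heeded : ∀ {K x} → ¬ Forces (opposite K) K x →
    ∃ λ w → heed K {K} {x} (safe K) [] ≡ just w × ¬ Forces (opposite K) (opposite K) w
  safe-heeded {K} {x} ¬d with em (SafeOption K x)
  ... | no ∄ = ⊥-elim (∄ (safe-option ¬d))
  ... | yes (j , ¬d′) = _ , proj₂ (pick-total (options K x) (λ _ → j) j) , ¬d′

  -- A move from a position where the opponent of K cannot force a win leads to
  -- another such position: by definition of Forces if it is the opponent's
  -- move, by the advice if it is K's.
  stays-unforced : ∀ {K M x y s} (e : x ≈ y) → ¬ Forces (opposite K) M x →
    (f : FirstMove (asking K {M} (safe K) e) s) →
    ∀ i → elem (options M x) i ≈ target f →
    ¬ Forces (opposite K) (opposite M) (elem (options M x) i)
  stays-unforced {K} {M} e ¬d f i e′ d with whose K M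
  ... | inj₂ t    = ¬d (choose t i d)
  ... | inj₁ refl =
    let w , eq , ¬w = safe-heeded {K} ¬d
    in ¬w (Forces-resp (≈-trans e′ (≈-sym (asked f refl eq))) d)

  safe-unlost : ∀ {K M x y} (e : x ≈ y) → ¬ Forces (opposite K) M x →
    ∀ π → Chain M y π → Obeys (asking K {M} (safe K) e) (fin π) →
    ¬ WinningPlay (opposite K) M y (fin π)
  safe-unlost e ¬d [] _ _ (stuck t none) =
    ¬d (Forces-resp (≈-sym e) (reply t λ i → ⊥-elim
      (none _ (∈-side t (i , ≈-refl)))))
  safe-unlost {K} {M} e ¬d (_ ∷ π) (m ∷ c) o win =
    let f = firstMove-fin (asking K {M} (safe K) e) m c o
        i , e′ = read M e m
    in safe-unlost e′ (stays-unforced e ¬d f i e′) π c (obeys f) (winning f win)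

  -- The play f ∗ f′

  -- A strategy detached from its seat, so that the part of it that remains
  -- after a move is again one.
  record Response (K M : Side) (x : Hypergame) : Set₁ where
    field
      ask      : Ask K M x
      respects : ∀ {π π′} (c : Chain M x π) (c′ : Chain M x π′) t t′ → π ≋ π′ →
        Maybe.Pointwise _≈_ (ask π c t) (ask π′ c′ t′)
      allowed  : ∀ {π} (c : Chain M x π) t {w} → ask π c t ≡ just w → w ∈[ K ] end x π
      total    : ∀ {π} (c : Chain M x π) t {w} → w ∈[ K ] end x π →
        ∃[ z ] ask π c t ≡ just z
  open Response

  after : ∀ {K M x y} → Response K M x → y ∈[ M ] x → Response K (opposite M) y
  after r m = record
    { ask      = askAfter (ask r) m
    ; respects = λ c c′ t t′ p → respects r (m ∷ c) (m ∷ c′) t t′ ((refl , ≈-refl) ∷ p)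
    ; allowed  = λ c → allowed r (m ∷ c)
    ; total    = λ c → total r (m ∷ c)
    }

  Duel : Side → Hypergame → Set₁
  Duel M x = ∀ K → Response K M x

  answer : ∀ {M x} → Duel M x → Maybe Hypergame
  answer {M} d = ask (d M) [] [] refl

  answer-allowed : ∀ {M x w} (d : Duel M x) → answer d ≡ just w → w ∈[ M ] x
  answer-allowed {M} d = allowed (d M) [] refl

  continue : ∀ {M x w} (d : Duel M x) → answer d ≡ just w → Duel (opposite M) w
  continue d eq K = after (d K) (answer-allowed d eq)

  -- Accessibility rather than a number of moves, so that both a halting and a
  -- non-halting duel pass their state on to the rest of the play.
  data Halts {M x} (d : Duel M x) : Set₁ where
    stop    : answer d ≡ nothing → Halts d
    further : ∀ {w} (eq : answer d ≡ just w) → Halts (continue d eq) → Halts d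

  -- Obedience in the form that induction on the play needs: π is a prefix of s
  -- only up to equality, so its answer equals the next move of s only up to ≈.
  Produces : ∀ {M x} → Duel M x → Sequence → Set₁
  Produces {M} {x} d s = ∀ K π (c : Chain M x π) (t : next M π ≡ K) → π ⊏ s →
    ∀ {w} → Maybe.Pointwise _≈_ (ask (d K) π c t) (just w) → fin (π ∷ʳ (K , w)) ⊑ s

  produces⇒obeys : ∀ {M x} {d : Duel M x} {s} → Produces d s →
    ∀ K → Obeys (ask (d K)) s
  produces⇒obeys p K π c t q eq =
    p K π c t q (Maybe.reflexive (λ { refl → ≈-refl }) eq)

  answer-≈ : ∀ {M x w v} (d : Duel M x) → answer d ≡ just w →
    Maybe.Pointwise _≈_ (answer d) (just v) → v ≈ w
  answer-≈ d eq p rewrite eq = ≈-sym (Maybe.drop-just p)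

  -- A play whose first move merely equals the one made is answered alike.
  continue-≈ : ∀ {M x w w′ K π v} (d : Duel M x) (eq : answer d ≡ just w)
    (m : w′ ∈[ M ] x) (c : Chain (opposite M) w′ π) (t : next (opposite M) π ≡ K)
    (e : w′ ≈ w) → Maybe.Pointwise _≈_ (ask (d K) _ (m ∷ c) t) (just v) →
    Maybe.Pointwise _≈_ (ask (continue d eq K) π (Chain-resp e c) t) (just v)
  continue-≈ {K = K} {π} d eq m c t e = Maybe.trans ≈-trans
    (respects (d K) {_ ∷ π} {_ ∷ π} (answer-allowed d eq ∷ Chain-resp e c) (m ∷ c) t t
      ((refl , ≈-sym e) ∷ ≋-refl π))

  data Over (M : Side) (x : Hypergame) : Sequence → Set₁ where
    noOption : ∀ {π} → (∀ y → ¬ y ∈[ next M π ] end x π) → Over M x (fin π)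
    endless  : ∀ {σ} → Over M x (inf σ)

  record Result {M x} (d : Duel M x) : Set₁ where
    field
      {sequence} : Sequence
      legalPlay  : IsPlay M x sequence
      produces   : Produces d sequence
      over       : Over M x sequence

  ended : ∀ {M x} {d : Duel M x} → Halts d → ∃ λ π →
    Chain M x π × Produces d (fin π) × (∀ y → ¬ y ∈[ next M π ] end x π)
  ended {M} {d = d} (stop eq) =
    [] , [] , (λ _ _ _ _ ()) , none
    where
    none : ∀ y → ¬ y ∈[ M ] _
    none y m with total (d M) [] refl m
    ... | z , eq′ with ≡.trans (≡.sym eq) eq′
    ...   | ()
  ended {M} {d = d} (further {w} eq h) with ended h
  ... | π , c , p , none = (M , w) ∷ π , answer-allowed d eq ∷ c , produces , none
    where
    produces : Produces d (fin ((M , w) ∷ π))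
    produces K [] [] refl _ a = (refl , answer-≈ d eq a) ∷ []
    produces K (_ ∷ ρ) (m ∷ c′) t ((_ , e) ∷ q , s≤s lt) a = (refl , e) ∷
      p K ρ (Chain-resp e c′) t (q , lt) (continue-≈ d eq m c′ t e a)

  record Endless : Set₁ where
    constructor state
    field
      {mover}    : Side
      {position} : Hypergame
      duel       : Duel mover position
      unhalted   : ¬ Halts duel
  open Endless

  answered : (s : Endless) → ∃ λ w → answer (duel s) ≡ just w
  answered (state d ¬h) with answer d in eq
  ... | just w  = w , refl
  ... | nothing = ⊥-elim (¬h (stop eq))

  advance : Endless → Endless
  advance s = let w , eq = answered s in
    state (continue (duel s) eq) (unhalted s ∘ further eq)

  forever : Endless → ℕ → Move
  forever s zero    = mover s , proj₁ (answered s)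
  forever s (suc n) = forever (advance s) n

  forever-play : ∀ s → IsPlay (mover s) (position s) (inf (forever s))
  forever-play s zero    = []
  forever-play s (suc n) =
    answer-allowed (duel s) (proj₂ (answered s)) ∷ forever-play (advance s) n

  forever-produces : ∀ s → Produces (duel s) (inf (forever s))
  forever-produces s K [] [] refl _ a =
    (refl , answer-≈ (duel s) (proj₂ (answered s)) a) ∷ []
  forever-produces s K (_ ∷ ρ) (m ∷ c) t ((_ , e) ∷ q) a = (refl , e) ∷
    forever-produces (advance s) K ρ (Chain-resp e c) t q
      (continue-≈ (duel s) (proj₂ (answered s)) m c t e a)

  result : ∀ {M x} (d : Duel M x) → Result d
  result d with em (Halts d)
  ... | yes h = let _ , c , p , none = ended h in
    record { legalPlay = c ; produces = p ; over = noOption none }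
  ... | no ¬h = record
    { legalPlay = forever-play (state d ¬h)
    ; produces  = forever-produces (state d ¬h)
    ; over      = endless
    }

  -- A proper prolongation of a finite play would contain an option at its end.
  over-maximal : ∀ {M x s} ρ → Over M x s → IsPlay M x ρ → s ⊑ ρ → ρ ⊑ s
  over-maximal (inf τ) endless _ p = λ n →
    let a , b = p n in ≡.sym a , ≈-sym b
  over-maximal (fin ρ) (noOption none) c p = go ≈-refl _ none c p
    where
    go : ∀ {M x y ρ} → x ≈ y → ∀ π → (∀ w → ¬ w ∈[ next M π ] end x π) →
      Chain M y ρ → Prefix _≈ₘ_ π ρ → Prefix _≈ₘ_ ρ π
    go e []      none []      []            = []
    go {M} e []  none (m ∷ _) []            = ⊥-elim (none _ (∈-resp M (≈-sym e) m))
    go e (_ ∷ π) none (m ∷ c) ((refl , e′) ∷ p) = (refl , ≈-sym e′) ∷ go e′ π none c p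
  over-maximal (inf τ) (noOption {π} none) c p =
    ⊥-elim (go ≈-refl π none (c (suc (length π))) p)
    where
    go : ∀ {M x y τ} → x ≈ y → ∀ π → (∀ w → ¬ w ∈[ next M π ] end x π) →
      Chain M y (applyUpTo τ (suc (length π))) → ¬ (π ≋ applyUpTo τ (length π))
    go {M} e [] none c _ = none _ (∈-resp M (≈-sym e) (proj₁ (proj₂ (uncons c))))
    go {τ = τ} e (_ ∷ π) none c ((refl , e′) ∷ p) with uncons c
    ... | refl , _ , c′ = go e′ π none c′ p

  response : ∀ P {x} → Strategy P x → Response (side P) (starter P) x
  response P f = record
    { ask      = λ π c t → Strategy.move f (record { moves = π ; isPlay = c ; isNext = t })
    ; respects = λ c c′ t t′ p → Strategy.cong f p
    ; allowed  = λ {π} c t eq → lastMove (side P) π (Strategy.legal f eq)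
    ; total    = λ c t m → Strategy.defined f (Chain-∷ʳ c t m)
    }

  duelOf : ∀ P {x} → Strategy P x → Strategy (opponent P) x → Duel (starter P) x
  duelOf LI  f f′ L = response LI f
  duelOf LI  f f′ R = response RII f′
  duelOf LII f f′ L = response LII f
  duelOf LII f f′ R = response RI f′
  duelOf RI  f f′ L = response LII f′
  duelOf RI  f f′ R = response RI f
  duelOf RII f f′ L = response LI f′
  duelOf RII f f′ R = response RII f

  duelOf-joint : ∀ P {x} (f : Strategy P x) (f′ : Strategy (opponent P) x) {s} →
    IsPlay (starter P) x s → (∀ K → Obeys (ask (duelOf P f f′ K)) s) →
    JointPlay f f′ s
  duelOf-joint LI  f f′ p o = record
    { play      = p
    ; coherent  = λ π → o L _ (isPlay π) (isNext π)
    ; coherent′ = λ π → o R _ (isPlay π) (isNext π)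
    }
  duelOf-joint LII f f′ p o = record
    { play      = p
    ; coherent  = λ π → o L _ (isPlay π) (isNext π)
    ; coherent′ = λ π → o R _ (isPlay π) (isNext π)
    }
  duelOf-joint RI  f f′ p o = record
    { play      = p
    ; coherent  = λ π → o R _ (isPlay π) (isNext π)
    ; coherent′ = λ π → o L _ (isPlay π) (isNext π)
    }
  duelOf-joint RII f f′ p o = record
    { play      = p
    ; coherent  = λ π → o R _ (isPlay π) (isNext π)
    ; coherent′ = λ π → o L _ (isPlay π) (isNext π)
    }

  outcome : ∀ {M x s} K → Over M x s →
    WinningPlay K M x s ⊎ Draw s ⊎ WinningPlay (opposite K) M x s
  outcome K endless = inj₂ (inj₁ infinite)
  outcome {M} K (noOption {π} none) with whose K (next M π)
  ... | inj₂ t = inj₁ (stuck t (≡.subst (λ J → ∀ y → ¬ y ∈[ J ] _) t none))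
  ... | inj₁ t = inj₂ (inj₂ (stuck t′ (≡.subst (λ J → ∀ y → ¬ y ∈[ J ] _) t′ none)))
    where t′ = ≡.trans t (≡.sym (opposite-involutive K))

  product : ∀ P {x} (f : Strategy P x) (f′ : Strategy (opponent P) x) →
    ∃ λ s → (f ∗ f′ ↦ s) × JointPlay f f′ s ×
      (WinningPlay (side P) (starter P) x s ⊎ Draw s
        ⊎ WinningPlay (opposite (side P)) (starter P) x s)
  product P f f′ = sequence
    , record { joint = j ; maximal = λ ρ j′ → over-maximal ρ over (JointPlay.play j′) }
    , j , outcome (side P) over
    where
    open Result (result (duelOf P f f′))
    j = duelOf-joint P f f′ legalPlay (produces⇒obeys {d = duelOf P f f′} produces)

  -- Forced wins and the strategies of the four seats

  SeatWins SeatNonLosing Forced : Seat → Hypergame → Set₁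
  SeatWins P x      = ∃ λ (f : Strategy P x) → Winning f
  SeatNonLosing P x = ∃ λ (f : Strategy P x) → NonLosing f
  Forced P          = Forces (side P) (starter P)

  opponent-forces : ∀ P {x} → Forces (opposite (side P)) (starter P) x →
    Forced (opponent P) x
  opponent-forces LI  = id
  opponent-forces LII = id
  opponent-forces RI  = id
  opponent-forces RII = id

  opponent-involutive : ∀ P → opponent (opponent P) ≡ P
  opponent-involutive LI  = refl
  opponent-involutive LII = refl
  opponent-involutive RI  = refl
  opponent-involutive RII = refl

  follower : ∀ P {x} → Forced P x → Strategy P x
  follower P d = advised P (follow d ≈-refl)

  follower-beats : ∀ P {x} (d : Forced P x) s →
    IsPlay (starter P) x s → Coherent (follower P d) s →
    ¬ NonLosingPlay (opposite (side P)) (starter P) x s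
  follower-beats P d s p c = follow-wins d ≈-refl ≈-refl s p
    λ π c′ t → c (record { moves = π ; isPlay = c′ ; isNext = t })

  forced⇒wins : ∀ P {x} → Forced P x → SeatWins P x
  forced⇒wins P {x} d = f , λ f′ →
    let s , s↦ , j , o = product P f f′
        beaten = follower-beats P d s (JointPlay.play j) (JointPlay.coherent j)
    in s , s↦ , [ id , (λ o′ → ⊥-elim (beaten ([ inj₂ , inj₁ ]′ o′))) ]′ o
    where f = follower P d

  unforced⇒nonLosing : ∀ P {x} → ¬ Forced (opponent P) x → SeatNonLosing P x
  unforced⇒nonLosing P {x} ¬d = f , λ f′ →
    let s , s↦ , j , o = product P f f′
        lost = unlost s (JointPlay.play j) (JointPlay.coherent j)
    in s , s↦ , [ inj₁ , [ inj₂ , (λ w → ⊥-elim (lost w)) ]′ ]′ o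
    where
    f = advised P (safe (side P))
    unlost : ∀ s → IsPlay (starter P) x s → Coherent f s →
      ¬ WinningPlay (opposite (side P)) (starter P) x s
    unlost (fin π) p c = safe-unlost ≈-refl (¬d ∘ opponent-forces P) π p
      λ π c′ t → c (record { moves = π ; isPlay = c′ ; isNext = t })

  -- The follower is itself one of the opponents that a non-losing strategy
  -- has to survive.
  forced⇒opponentLoses : ∀ P {x} → Forced (opponent P) x → ¬ SeatNonLosing P x
  forced⇒opponentLoses P d (f , nl) =
    let s , s↦ , nls = nl (follower (opponent P) d)
    in beaten P d s (_∗_↦_.joint s↦) nls
    where
    beaten : ∀ P {x} (d : Forced (opponent P) x) s {f : Strategy P x} →
      JointPlay f (follower (opponent P) d) s → ¬ NonLosingPlay (side P) (starter P) x s
    beaten LI  d s j = follower-beats RII d s (JointPlay.play j) (JointPlay.coherent′ j)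
    beaten LII d s j = follower-beats RI  d s (JointPlay.play j) (JointPlay.coherent′ j)
    beaten RI  d s j = follower-beats LII d s (JointPlay.play j) (JointPlay.coherent′ j)
    beaten RII d s j = follower-beats LI  d s (JointPlay.play j) (JointPlay.coherent′ j)

  winning⇒nonLosing : ∀ {P x} → SeatWins P x → SeatNonLosing P x
  winning⇒nonLosing (f , w) = f , λ f′ → let s , s↦ , ws = w f′ in s , s↦ , inj₁ ws

  data Verdict (P : Seat) (x : Hypergame) : Set₁ where
    won   : SeatWins P x → ¬ SeatNonLosing (opponent P) x → Verdict P x
    lost  : SeatWins (opponent P) x → ¬ SeatNonLosing P x → Verdict P x
    drawn : SeatNonLosing P x → SeatNonLosing (opponent P) x → Verdict P x

  verdict : ∀ P x → Verdict P x
  verdict P x with em (Forced P x) | em (Forced (opponent P) x)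
  ... | yes d | _      = won (forced⇒wins P d) (forced⇒opponentLoses (opponent P)
    (≡.subst (λ Q → Forced Q x) (≡.sym (opponent-involutive P)) d))
  ... | no _  | yes d′ = lost (forced⇒wins (opponent P) d′) (forced⇒opponentLoses P d′)
  ... | no ¬d | no ¬d′ = drawn (unforced⇒nonLosing P ¬d′) (unforced⇒nonLosing (opponent P)
    (¬d ∘ ≡.subst (λ Q → Forced Q x) (opponent-involutive P)))

  -- From seats to players

  Classification : Hypergame → Set₁
  Classification x = (ExactlyOneWins x ⊎ AtLeastTwoNonLosing x)
    × (AtLeastTwoNonLosing x →
        (EitherNotBoth (HasNonLosing L x) (HasNonLosing R x)
          × EitherNotBoth (HasNonLosing I x) (HasNonLosing II x))
        ⊎ (∀ p → HasNonLosing p x))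

  module _ {x : Hypergame} where

    bothWin : ∀ p → SeatWins (seat₁ p) x → SeatWins (seat₂ p) x → HasWinning p x
    bothWin p (f , w) (g , v) = (f , g) , w , v

    both : ∀ p → SeatNonLosing (seat₁ p) x → SeatNonLosing (seat₂ p) x → HasNonLosing p x
    both p (f , w) (g , v) = (f , g) , w , v

    first : ∀ p → HasNonLosing p x → SeatNonLosing (seat₁ p) x
    first p ((f , _) , w , _) = f , w

    second : ∀ p → HasNonLosing p x → SeatNonLosing (seat₂ p) x
    second p ((_ , g) , _ , v) = g , v

    oneWinner : ∀ p → HasWinning p x → (∀ q → q ≢ p → ¬ HasNonLosing q x) →
      Classification x
    oneWinner p w others =
      inj₁ (p , w , (λ q v → only q (survives q v)) , others) ,
      λ (q , r , q≢r , n , n′) → ⊥-elim (q≢r (≡.trans (only q n) (≡.sym (only r n′))))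
      where
      only : ∀ q → HasNonLosing q x → q ≡ p
      only q n = decidable-stable (q ≟ p) λ q≢p → others q q≢p n
      survives : ∀ q → HasWinning q x → HasNonLosing q x
      survives q ((f , g) , w , v) =
        both q (winning⇒nonLosing (f , w)) (winning⇒nonLosing (g , v))

    oneOfEach : EitherNotBoth (HasNonLosing L x) (HasNonLosing R x) →
      EitherNotBoth (HasNonLosing I x) (HasNonLosing II x) → Classification x
    oneOfEach a@(lr , _) b@(ij , _) = inj₂ (two lr ij) , λ _ → inj₁ (a , b)
      where
      two : HasNonLosing L x ⊎ HasNonLosing R x → HasNonLosing I x ⊎ HasNonLosing II x →
        AtLeastTwoNonLosing x
      two (inj₁ m) (inj₁ n) = L , I  , (λ ()) , m , n
      two (inj₁ m) (inj₂ n) = L , II , (λ ()) , m , n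
      two (inj₂ m) (inj₁ n) = R , I  , (λ ()) , m , n
      two (inj₂ m) (inj₂ n) = R , II , (λ ()) , m , n

    everyone : (∀ p → HasNonLosing p x) → Classification x
    everyone n = inj₂ (L , R , (λ ()) , n L , n R) , λ _ → inj₂ n

    -- A player is spoilt by either of its two seats, and each seat belongs to
    -- one of L, R and to one of I, II.
    classify : Verdict LI x → Verdict LII x → Classification x
    classify (won  li  ¬rii) (won  lii ¬ri)  = oneWinner L (bothWin L li lii) λ where
      L  ≢p → ⊥-elim (≢p refl)
      R  _  → ¬ri ∘ first R
      I  _  → ¬ri ∘ second I
      II _  → ¬rii ∘ second II
    classify (won  li  ¬rii) (lost ri  ¬lii) = oneWinner I (bothWin I li ri) λ where
      L  _  → ¬lii ∘ second L
      R  _  → ¬rii ∘ second R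
      I  ≢p → ⊥-elim (≢p refl)
      II _  → ¬rii ∘ second II
    classify (lost rii ¬li)  (won  lii ¬ri)  = oneWinner II (bothWin II lii rii) λ where
      L  _  → ¬li ∘ first L
      R  _  → ¬ri ∘ first R
      I  _  → ¬li ∘ first I
      II ≢p → ⊥-elim (≢p refl)
    classify (lost rii ¬li)  (lost ri  ¬lii) = oneWinner R (bothWin R ri rii) λ where
      L  _  → ¬li ∘ first L
      R  ≢p → ⊥-elim (≢p refl)
      I  _  → ¬li ∘ first I
      II _  → ¬lii ∘ first II
    classify (won  li  ¬rii) (drawn lii ri)  = oneOfEach
      (inj₁ (both L (winning⇒nonLosing li) lii) , ¬rii ∘ second R ∘ proj₂)
      (inj₁ (both I (winning⇒nonLosing li) ri)  , ¬rii ∘ second II ∘ proj₂)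
    classify (lost rii ¬li)  (drawn lii ri)  = oneOfEach
      (inj₂ (both R ri (winning⇒nonLosing rii))   , ¬li ∘ first L ∘ proj₁)
      (inj₂ (both II lii (winning⇒nonLosing rii)) , ¬li ∘ first I ∘ proj₁)
    classify (drawn li rii)  (won  lii ¬ri)  = oneOfEach
      (inj₁ (both L li (winning⇒nonLosing lii))   , ¬ri ∘ first R ∘ proj₂)
      (inj₂ (both II (winning⇒nonLosing lii) rii) , ¬ri ∘ second I ∘ proj₁)
    classify (drawn li rii)  (lost ri  ¬lii) = oneOfEach
      (inj₂ (both R (winning⇒nonLosing ri) rii) , ¬lii ∘ second L ∘ proj₁)
      (inj₁ (both I li (winning⇒nonLosing ri))  , ¬lii ∘ first II ∘ proj₂)
    classify (drawn li rii)  (drawn lii ri)  = everyone λ where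
      L  → both L li lii
      R  → both R ri rii
      I  → both I li ri
      II → both II lii rii

theorem2p14 : AxiomOfChoice 0ℓ 1ℓ → (𝓗 : FinalCoalgebra) → let open Games 𝓗 in
    (x : Hypergame) →
    (ExactlyOneWins x ⊎ AtLeastTwoNonLosing x)
    × (AtLeastTwoNonLosing x →
    (EitherNotBoth (HasNonLosing L x) (HasNonLosing R x)
    × EitherNotBoth (HasNonLosing I x) (HasNonLosing II x))
    ⊎ (∀ p → HasNonLosing p x))
theorem2p14 choice 𝓗 x = classify (verdict LI x) (verdict LII x)
  where open Determinacy choice 𝓗
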